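{- Let $\Sigma=\{a,b,c\}$ be an alphabet with three distinct letters and let $w,w'\in\Sigma^*$ satisfy $|w|_{abc}=|w'|_{abc}\le 1$. Then $w$ and $w'$ are strongly $M$-equivalent if and only if $w$ and $w'$ are $M\!S\!E$-equivalent.
   Context: For words $w,u\in\Sigma^*$, $|w|_u$ is the number of occurrences of $u$ as a scattered subword of $w$ (two occurrences are different iff they differ in at least one position of some letter); $|w|_\lambda=1$ for the empty word $\lambda$. Parikh matrices: for an ordered alphabet $\Gamma=\{a_1<a_2<\dots<a_s\}$, the Parikh matrix mapping $\Psi_\Gamma:\Gamma^*\to\mathcal M_{s+1}$ is the monoid morphism into the multiplicative monoid of $(s+1)\times(s+1)$ upper triangular matrices with nonnegative integer entries and unit diagonal that sends $a_q$ to the matrix with $1$'s on the diagonal, $1$ in position $(q,q+1)$, and $0$ elsewhere. Two words are $M$-equivalent with respect to $\Gamma$ iff they have the same image under $\Psi_\Gamma$. Strong $M$-equivalence: for an (unordered) alphabet $\Sigma$, words $w,w'\in\Sigma^*$ are strongly $M$-equivalent iff they are $M$-equivalent with respect to every ordered alphabet whose underlying set is $\Sigma$. $M\!S\!E$-equivalence: Rule $S\!E$ allows one to replace a word $x\alpha\beta y\beta\alpha z$ by $x\beta\alpha y\alpha\beta z$, where $\alpha,\beta\in\Sigma$, $x,z\in\Sigma^*$ and $y\in\{\alpha,\beta\}^*$. Words $w,w'\in\Sigma^*$ are $M\!S\!E$-equivalent iff $w'$ results from $w$ by finitely many (possibly zero) applications of Rule $S\!E$. -}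

module Defs where

open import Algebra.Definitions.RawMonoid using (sum)
open import Data.Bool using (if_then_else_; _∨_; _∧_)
open import Data.Fin using (Fin; suc; inject₁)
open import Data.Fin.Properties using () renaming (_≟_ to _≟ᶠ_)
open import Data.List using (List; []; _∷_; _++_; map; filter; length; foldr)
open import Data.List.Properties using (≡-dec)
open import Data.List.Relation.Unary.All using (All)
open import Data.Nat using (ℕ; _*_; +-0-rawMonoid)
open import Data.Sum using (_⊎_)
open import Function.Bundles using (_↔_; module Inverse)
open import Relation.Binary.Construct.Closure.ReflexiveTransitive using (Star)
open import Relation.Binary.Definitions using (DecidableEquality)
open import Relation.Binary.PropositionalEquality using (_≡_; refl)
open import Relation.Nullary using (yes; no)
open import Relation.Nullary.Decidable using (⌊_⌋)

private
  variable
    A : Set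
    n s : ℕ

-- One entry for each set of positions of w, namely the word read off at those
-- positions; equal words at different position sets are listed separately.
subwords : List A → List (List A)
subwords []      = [] ∷ []
subwords (x ∷ w) = map (x ∷_) (subwords w) ++ subwords w

-- |w|_u
occurrences : DecidableEquality A → List A → List A → ℕ
occurrences _≟_ w u = length (filter (λ v → ≡-dec _≟_ v u) (subwords w))

Matrix : ℕ → Set
Matrix n = Fin n → Fin n → ℕ

identity : Matrix n
identity i j = if ⌊ i ≟ᶠ j ⌋ then 1 else 0

infixl 7 _⊗_
_⊗_ : Matrix n → Matrix n → Matrix n
(M ⊗ N) i j = sum +-0-rawMonoid (λ k → M i k * N k j)

-- With indices counted from 0, the letter number q has its off-diagonal 1 in
-- row q and column q + 1, that is, at (inject₁ q , suc q).
elementary : Fin s → Matrix (ℕ.suc s)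
elementary q i j =
  if ⌊ i ≟ᶠ j ⌋ ∨ (⌊ i ≟ᶠ inject₁ q ⌋ ∧ ⌊ j ≟ᶠ suc q ⌋) then 1 else 0

-- An ordered alphabet a₁ < a₂ < … < a_s with underlying set A, given as the
-- bijection sending each letter to its (0-based) place in the order.
OrderedAlphabet : Set → ℕ → Set
OrderedAlphabet A s = A ↔ Fin s

parikh : OrderedAlphabet A s → List A → Matrix (ℕ.suc s)
parikh Γ = foldr (λ x M → elementary (Inverse.to Γ x) ⊗ M) identity

-- Matrices are functions, so their equality is stated entrywise.
MEquivalent : OrderedAlphabet A s → List A → List A → Set
MEquivalent Γ w w′ = ∀ i j → parikh Γ w i j ≡ parikh Γ w′ i j

StronglyMEquivalent : List A → List A → Set
StronglyMEquivalent {A} w w′ =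
  ∀ (s : ℕ) (Γ : OrderedAlphabet A s) → MEquivalent Γ w w′

data RuleSE {A : Set} : List A → List A → Set where
  swap : ∀ (x : List A) (α β : A) (y z : List A) →
         All (λ γ → γ ≡ α ⊎ γ ≡ β) y →
         RuleSE (x ++ α ∷ β ∷ y ++ β ∷ α ∷ z)
                (x ++ β ∷ α ∷ y ++ α ∷ β ∷ z)

MSEEquivalent : List A → List A → Set
MSEEquivalent = Star RuleSE

data Letter : Set where
  a b c : Letter

_≟_ : DecidableEquality Letter
a ≟ a = yes refl
a ≟ b = no λ ()
a ≟ c = no λ ()
b ≟ a = no λ ()
b ≟ b = yes refl
b ≟ c = no λ ()
c ≟ a = no λ ()
c ≟ b = no λ ()
c ≟ c = yes refl

{-# OPTIONS --safe #-}

-- Each entry of a Parikh matrix is a scattered-subword count |w|_u with u free of repeated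
-- letters, and Rule SE preserves all of these; this is soundness.  For completeness, words
-- over two letters are MSE-equivalent as soon as their counts |w|_α, |w|_β, |w|_αβ agree,
-- because every such word reduces to α^s β^m or β^k α^s β α^(t+1) β^m, whose parameters are
-- read off by division with remainder.
--
-- A word with |w|_abc = 1 is p a c^i b a^j c s with p over {b,c} and s over {a,b}.  Here
-- |w|_ac = i + 1 + j and |w|_acb = i + |s|_b |w|_ac, so division determines i and |s|_b, hence
-- all counts of p and s.  A word with |w|_abc = 0 is p q r with p, q, r over {b,c}, {a,c} and
-- {a,b}.  If |w|_ac > 0 then |w|_acb = |w|_ac |r|_b determines |r|_b and |p|_b; trading the last
-- c's of p and the first a's of r against q makes p and r agree with those of the other word,
-- and then q agrees as a binary word.  If |w|_ac = 0 then q can be absorbed into p and r, and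
-- the b's at the border of p and r are traded instead.
module Submission where

open import Defs
open import Data.Bool using (true; false; if_then_else_; _∧_)
open import Data.Fin using (Fin; zero; suc; inject₁; toℕ; lower₁)
open import Data.Fin.Patterns using (0F; 1F; 2F)
open import Data.Fin.Properties using (toℕ-inject₁; toℕ<n; toℕ-injective; inject₁-lower₁; inject₁-injective; punchInᵢ≢i)
  renaming (_≟_ to _≟ᶠ_)
open import Data.List using (List; []; _∷_; _++_; [_]; map; filter; length; replicate)
open import Data.List.Properties using (≡-dec; filter-++; length-++; ++-assoc; ++-identityʳ)
open import Data.List.Relation.Unary.All using (All; []; _∷_)
import Data.List.Relation.Unary.All as All
open import Data.List.Relation.Unary.All.Properties using (++⁺; replicate⁺)
open import Data.List.Relation.Unary.AllPairs using ([]; _∷_)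
open import Data.List.Relation.Unary.Unique.Propositional using (Unique)
open import Data.Nat using (ℕ; zero; suc; _+_; _*_; _∸_; _≤_; _<_; z≤n; s≤s; s≤s⁻¹)
open import Data.Nat.Properties hiding (_≟_)
open import Data.Nat.Tactic.RingSolver using (solve-∀)
open import Data.Product using (∃; ∃₂; _×_; _,_; proj₁; proj₂)
open import Data.Sum using (_⊎_; inj₁; inj₂)
import Data.Sum as Sum
open import Function using (_∘_)
open import Function.Bundles using (_⇔_; module Inverse; mk↔ₛ′; mk⇔)
open import Relation.Binary.Construct.Closure.ReflexiveTransitive using (ε; _◅_; _◅◅_; gmap; reverse)
open import Relation.Binary.Definitions using (DecidableEquality)
open import Relation.Binary.PropositionalEquality hiding ([_])
open import Relation.Nullary using (does; yes; no; contradiction)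
open import Relation.Nullary.Decidable using (dec-true; dec-false; ⌊_⌋)
open import Algebra.Properties.CommutativeSemigroup +-commutativeSemigroup using (x∙yz≈y∙xz)
import Algebra.Properties.CommutativeMonoid.Sum +-0-commutativeMonoid as Sum+

-- Scattered-subword counts

module Counting {A : Set} (_≈?_ : DecidableEquality A) where

  -- The two summands separate the occurrences that use the first letter of the word from those that
  -- do not. This form of |w|_u, with the subword as first argument, reduces along the word and
  -- suits induction better than filtering `subwords`.
  count : List A → List A → ℕ
  count []      w       = 1
  count (x ∷ u) []      = 0
  count (x ∷ u) (y ∷ w) = (if does (y ≈? x) then count u w else 0) + count (x ∷ u) w

  count-here : ∀ x u w → count (x ∷ u) (x ∷ w) ≡ count u w + count (x ∷ u) w
  count-here x u w rewrite dec-true (x ≈? x) refl = refl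

  count-there : ∀ {x y} u w → y ≢ x → count (x ∷ u) (y ∷ w) ≡ count (x ∷ u) w
  count-there {x} {y} u w y≢x rewrite dec-false (y ≈? x) y≢x = refl

  private
    tally : List A → List (List A) → ℕ
    tally u l = length (filter (λ v → ≡-dec _≈?_ v u) l)

    tally-++ : ∀ u k l → tally u (k ++ l) ≡ tally u k + tally u l
    tally-++ u k l = trans (cong length (filter-++ (λ v → ≡-dec _≈?_ v u) k l)) (length-++ (filter _ k))

    tally-map-[] : ∀ y l → tally [] (map (y ∷_) l) ≡ 0
    tally-map-[] y []      = refl
    tally-map-[] y (v ∷ l) = tally-map-[] y l

    tally-map-here : ∀ x u l → tally (x ∷ u) (map (x ∷_) l) ≡ tally u l
    tally-map-here x u []      = refl
    tally-map-here x u (v ∷ l) rewrite dec-true (x ≈? x) refl with does (≡-dec _≈?_ v u)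
    ... | true  = cong suc (tally-map-here x u l)
    ... | false = tally-map-here x u l

    tally-map-there : ∀ {x y} u l → y ≢ x → tally (x ∷ u) (map (y ∷_) l) ≡ 0
    tally-map-there         u []      y≢x = refl
    tally-map-there {x} {y} u (v ∷ l) y≢x
      rewrite dec-false (y ≈? x) y≢x = tally-map-there u l y≢x

  occurrences≡count : ∀ w u → occurrences _≈?_ w u ≡ count u w
  occurrences≡count []      []      = refl
  occurrences≡count []      (x ∷ u) = refl
  occurrences≡count (y ∷ w) []      = trans (tally-++ [] (map (y ∷_) (subwords w)) (subwords w))
    (cong₂ _+_ (tally-map-[] y (subwords w)) (occurrences≡count w []))
  occurrences≡count (y ∷ w) (x ∷ u)
    with y ≈? x | tally-++ (x ∷ u) (map (y ∷_) (subwords w)) (subwords w) | occurrences≡count w (x ∷ u)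
  ... | yes refl | split | ih = trans split
    (cong₂ _+_ (trans (tally-map-here y u (subwords w)) (occurrences≡count w u)) ih)
  ... | no y≢x   | split | ih = trans split (cong₂ _+_ (tally-map-there u (subwords w) y≢x) ih)

  count-++₁ : ∀ x v w → count [ x ] (v ++ w) ≡ count [ x ] v + count [ x ] w
  count-++₁ x []      w = refl
  count-++₁ x (z ∷ v) w rewrite count-++₁ x v w = sym (+-assoc (if does (z ≈? x) then 1 else 0) _ _)

  -- An occurrence lies inside `v`, is cut between its two letters, or lies inside `w`. For three
  -- letters there are two places to cut.
  count-++₂ : ∀ x y v w → count (x ∷ y ∷ []) (v ++ w) ≡
              count (x ∷ y ∷ []) v + (count [ x ] v * count [ y ] w + count (x ∷ y ∷ []) w)
  count-++₂ x y []      w = refl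
  count-++₂ x y (z ∷ v) w rewrite count-++₂ x y v w | count-++₁ y v w with does (z ≈? x)
  ... | false = refl
  ... | true  = rearrange (count [ y ] v) (count [ y ] w) (count (x ∷ y ∷ []) v) (count [ x ] v) (count (x ∷ y ∷ []) w)
    where
    rearrange : ∀ k l m n o → k + l + (m + (n * l + o)) ≡ k + m + ((1 + n) * l + o)
    rearrange = solve-∀

  count-++₃ : ∀ x y z v w → count (x ∷ y ∷ z ∷ []) (v ++ w) ≡
              count (x ∷ y ∷ z ∷ []) v + (count (x ∷ y ∷ []) v * count [ z ] w +
              (count [ x ] v * count (y ∷ z ∷ []) w + count (x ∷ y ∷ z ∷ []) w))
  count-++₃ x y z []      w = refl
  count-++₃ x y z (t ∷ v) w rewrite count-++₃ x y z v w | count-++₂ y z v w with does (t ≈? x)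
  ... | false = refl
  ... | true  = rearrange (count (y ∷ z ∷ []) v) (count [ y ] v) (count [ z ] w) (count (y ∷ z ∷ []) w)
                          (count (x ∷ y ∷ z ∷ []) v) (count (x ∷ y ∷ []) v) (count [ x ] v) (count (x ∷ y ∷ z ∷ []) w)
    where
    rearrange : ∀ k l m n o p q r →
                k + (l * m + n) + (o + (p * m + (q * n + r))) ≡ k + o + ((l + p) * m + ((1 + q) * n + r))
    rearrange = solve-∀

  count-skip : ∀ {x} u {v} w → All (_≢ x) v → count (x ∷ u) (v ++ w) ≡ count (x ∷ u) w
  count-skip u w []          = refl
  count-skip u w (y≢x ∷ v≢x) = trans (count-there u _ y≢x) (count-skip u w v≢x)

  count-absent₁ : ∀ {x v} u → All (_≢ x) v → count (x ∷ u) v ≡ 0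
  count-absent₁ u []          = refl
  count-absent₁ u (y≢x ∷ v≢x) = trans (count-there u _ y≢x) (count-absent₁ u v≢x)

  count-absent₂ : ∀ {x y v} u → All (_≢ y) v → count (x ∷ y ∷ u) v ≡ 0
  count-absent₂             u []                      = refl
  count-absent₂ {x} {y} u (_∷_ {x = z} z≢y v≢y) with does (z ≈? x)
  ... | true  = cong₂ _+_ (count-absent₁ u v≢y) (count-absent₂ u v≢y)
  ... | false = count-absent₂ u v≢y

  -- Deleting the first letter of an occurrence of `x ∷ u` leaves an occurrence of `u`.
  count-cons-zero : ∀ x u w → count u w ≡ 0 → count (x ∷ u) w ≡ 0
  count-cons-zero x (y ∷ u) []      _  = refl
  count-cons-zero x (y ∷ u) (z ∷ w) eq with zero-tail ← m+n≡0⇒n≡0 (if does (z ≈? y) then count u w else 0) eq with does (z ≈? x)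
  ... | true  = cong₂ _+_ zero-tail (count-cons-zero x (y ∷ u) w zero-tail)
  ... | false = count-cons-zero x (y ∷ u) w zero-tail

  count-replicate : ∀ x n → count [ x ] (replicate n x) ≡ n
  count-replicate x zero    = refl
  count-replicate x (suc n) = trans (count-here x [] (replicate n x)) (cong suc (count-replicate x n))

-- Entries of Parikh matrices as subword counts

sum-single : ∀ {n} (f : Fin n → ℕ) i → (∀ k → k ≢ i → f k ≡ 0) → Sum+.sum f ≡ f i
sum-single {suc n} f i vanish = trans (Sum+.sum-remove {i = i} f)
  (trans (cong (f i +_) (trans (Sum+.sum-cong-≗ (λ k → vanish _ (punchInᵢ≢i i k))) (Sum+.sum-replicate-zero n)))
         (+-identityʳ (f i)))

suc≢inject₁ : ∀ {n} {q : Fin n} → suc q ≢ inject₁ q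
suc≢inject₁ {q = q} eq = 1+n≢n (trans (cong toℕ eq) (toℕ-inject₁ q))

-- An elementary matrix is the identity plus a single off-diagonal one, so multiplying by it from
-- the left is a row operation.
elementary-row : ∀ {s} (q : Fin s) (M : Matrix (suc s)) i j →
                 (elementary q ⊗ M) i j ≡ M i j + (if does (i ≟ᶠ inject₁ q) then M (suc q) j else 0)
elementary-row {s} q M i j = begin
  Sum+.sum (λ k → elementary q i k * M k j)    ≡⟨ Sum+.sum-cong-≗ split ⟩
  Sum+.sum (λ k → diagonal k + offDiagonal k)  ≡⟨ Sum+.∑-distrib-+ diagonal offDiagonal ⟩
  Sum+.sum diagonal + Sum+.sum offDiagonal     ≡⟨ cong₂ _+_ (sum-single diagonal i diagonal-zero) (sum-single offDiagonal (suc q) offDiagonal-zero) ⟩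
  diagonal i + offDiagonal (suc q)             ≡⟨ cong₂ _+_ diagonal-value offDiagonal-value ⟩
  M i j + (if does (i ≟ᶠ inject₁ q) then M (suc q) j else 0) ∎
  where
  open ≡-Reasoning
  diagonal offDiagonal : Fin (suc s) → ℕ
  diagonal k    = if ⌊ i ≟ᶠ k ⌋ then M k j else 0
  offDiagonal k = if ⌊ i ≟ᶠ inject₁ q ⌋ ∧ ⌊ k ≟ᶠ suc q ⌋ then M k j else 0

  split : ∀ k → elementary q i k * M k j ≡ diagonal k + offDiagonal k
  split k with i ≟ᶠ k | i ≟ᶠ inject₁ q | k ≟ᶠ suc q
  -- The disjunction in `elementary` acts as a sum because its two cases exclude each other: the
  -- off-diagonal one is not on the diagonal.
  ... | yes refl | yes p | yes r = contradiction (trans (sym r) p) suc≢inject₁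
  ... | yes refl | yes _ | no _  = refl
  ... | yes refl | no _  | _     = refl
  ... | no _     | yes _ | yes _ = +-identityʳ _
  ... | no _     | yes _ | no _  = refl
  ... | no _     | no _  | _     = refl

  diagonal-zero : ∀ k → k ≢ i → diagonal k ≡ 0
  diagonal-zero k k≢i with i ≟ᶠ k
  ... | yes refl = contradiction refl k≢i
  ... | no _     = refl

  offDiagonal-zero : ∀ k → k ≢ suc q → offDiagonal k ≡ 0
  offDiagonal-zero k k≢ with i ≟ᶠ inject₁ q | k ≟ᶠ suc q
  ... | _     | yes p = contradiction p k≢
  ... | yes _ | no _  = refl
  ... | no _  | no _  = refl

  diagonal-value : diagonal i ≡ M i j
  diagonal-value with i ≟ᶠ i
  ... | yes _  = refl
  ... | no i≢i = contradiction refl i≢i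

  offDiagonal-value : offDiagonal (suc q) ≡ (if does (i ≟ᶠ inject₁ q) then M (suc q) j else 0)
  offDiagonal-value with i ≟ᶠ inject₁ q | suc q ≟ᶠ suc q
  ... | _     | no q≢q = contradiction refl q≢q
  ... | yes _ | yes _  = refl
  ... | no _  | yes _  = refl

-- `Segment Γ j i u` says that `u` lists, in increasing order, the letters at places i, i + 1, ...,
-- j - 1. This is the word counted by the matrix entry (i, j).
data Segment {A : Set} {s : ℕ} (Γ : OrderedAlphabet A s) (j : Fin (suc s)) : Fin (suc s) → List A → Set where
  stop : Segment Γ j j []
  step : ∀ q {u} → Segment Γ j (suc q) u → Segment Γ j (inject₁ q) (Inverse.from Γ q ∷ u)

module _ {A : Set} {s : ℕ} (Γ : OrderedAlphabet A s) where
  open Inverse Γ using (to; from; strictlyInverseˡ; strictlyInverseʳ)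

  segment-≤ : ∀ {i j u} → Segment Γ j i u → toℕ i ≤ toℕ j
  segment-≤ stop                    = ≤-refl
  segment-≤ {j = j} (step q {u} seg) = subst (_≤ toℕ j) (sym (toℕ-inject₁ q)) (<⇒≤ (segment-≤ seg))

  segment-∉ : ∀ {i j u} → Segment Γ j i u → ∀ {p} → toℕ p < toℕ i → All (from p ≢_) u
  segment-∉ stop               p<i = []
  segment-∉ (step q seg) {p}   p<i =
    (λ eq → <⇒≢ p<q (cong toℕ (trans (sym (strictlyInverseˡ p)) (trans (cong to eq) (strictlyInverseˡ q)))))
    ∷ segment-∉ seg (m<n⇒m<1+n p<q)
    where p<q = subst (toℕ p <_) (toℕ-inject₁ q) p<i

  segment-unique : ∀ {i j u} → Segment Γ j i u → Unique u
  segment-unique stop         = []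
  segment-unique (step q seg) = segment-∉ seg ≤-refl ∷ segment-unique seg

  segment : ∀ d {i j : Fin (suc s)} → toℕ i + d ≡ toℕ j → ∃ (Segment Γ j i)
  segment zero    {i} eq with refl ← toℕ-injective (trans (sym (+-identityʳ (toℕ i))) eq) = [] , stop
  segment (suc d) {i} {j} eq
    -- Since i < j ≤ s, row i is not the last one and therefore belongs to a letter.
    with lower₁ i s≢i | inject₁-lower₁ i s≢i
    where
    s≢i : s ≢ toℕ i
    s≢i s≡i = <⇒≢ (<-≤-trans (m<m+n (toℕ i) (s≤s z≤n)) (≤-trans (≤-reflexive eq) (s≤s⁻¹ (toℕ<n j)))) (sym s≡i)
  ... | q | refl with segment d {suc q} (trans (cong (λ t → suc t + d) (sym (toℕ-inject₁ q))) (trans (sym (+-suc _ d)) eq))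
  ...   | u , seg = from q ∷ u , step q seg

  -- A row operation only adds the next lower row, whose entry in column j is further below the
  -- diagonal and already zero.
  parikh-lower : ∀ w {i j} → toℕ j < toℕ i → parikh Γ w i j ≡ 0
  parikh-lower [] {i} {j} j<i with i ≟ᶠ j
  ... | yes refl = contradiction refl (<⇒≢ j<i)
  ... | no _     = refl
  parikh-lower (x ∷ w) {i} {j} j<i rewrite elementary-row (to x) (parikh Γ w) i j | parikh-lower w j<i
    with i ≟ᶠ inject₁ (to x)
  ... | no _     = refl
  ... | yes refl = parikh-lower w (m<n⇒m<1+n (subst (toℕ j <_) (toℕ-inject₁ (to x)) j<i))

  module _ (_≈?_ : DecidableEquality A) where
    open Counting _≈?_

    -- The row operation of a letter matches the recursion of `count`: row i receives row i + 1
    -- exactly when the letter read is the first letter of the segment word.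
    parikh≡count : ∀ {i j u} → Segment Γ j i u → ∀ w → parikh Γ w i j ≡ count u w
    parikh≡count {j = j} stop [] with j ≟ᶠ j
    ... | yes _  = refl
    ... | no j≢j = contradiction refl j≢j
    parikh≡count {j = j} (step q seg) [] with inject₁ q ≟ᶠ j
    ... | yes refl = contradiction (toℕ-inject₁ q) (>⇒≢ (segment-≤ seg))
    ... | no _     = refl
    parikh≡count {i} stop (x ∷ w)
      rewrite elementary-row (to x) (parikh Γ w) i i | parikh≡count {i} stop w
      with i ≟ᶠ inject₁ (to x)
    -- The entry added to a diagonal one comes from below the diagonal, so it is zero.
    ... | yes refl = cong suc (parikh-lower w (s≤s (≤-reflexive (toℕ-inject₁ (to x)))))
    ... | no _     = refl
    parikh≡count {i} {j} (step q {u} seg) (x ∷ w)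
      rewrite elementary-row (to x) (parikh Γ w) i j | parikh≡count (step q seg) w
      with inject₁ q ≟ᶠ inject₁ (to x) | x ≈? from q
    ... | yes p  | no x≢  = contradiction (trans (sym (strictlyInverseʳ x)) (cong from (sym (inject₁-injective p)))) x≢
    ... | no p   | yes x≡ = contradiction (cong inject₁ (trans (sym (strictlyInverseˡ q)) (cong to (sym x≡)))) p
    ... | no _   | no _   = +-identityʳ _
    ... | yes p  | yes _  with refl ← inject₁-injective p =
      trans (cong (count (from q ∷ u) w +_) (parikh≡count seg w)) (+-comm _ (count u w))

-- The congruence generated by Rule SE

Over : {A : Set} → A → A → List A → Set
Over α β = All (λ γ → γ ≡ α ⊎ γ ≡ β)

over-sym : {A : Set} {α β : A} {w : List A} → Over α β w → Over β α w
over-sym = All.map Sum.swap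

over-≢ : {A : Set} {α β γ : A} {w : List A} → α ≢ γ → β ≢ γ → Over α β w → All (_≢ γ) w
over-≢ α≢γ β≢γ = All.map λ where
  (inj₁ refl) → α≢γ
  (inj₂ refl) → β≢γ

infix 4 _∼_
_∼_ : {A : Set} → List A → List A → Set
_∼_ = MSEEquivalent

-- An application of Rule SE is undone by the rule with α and β exchanged.
∼-sym : {A : Set} {u v : List A} → u ∼ v → v ∼ u
∼-sym = reverse λ where (swap x α β y z over) → swap x β α y z (over-sym over)

∼-cons : {A : Set} (x : A) {u v : List A} → u ∼ v → x ∷ u ∼ x ∷ v
∼-cons t = gmap (t ∷_) λ where (swap x α β y z over) → swap (t ∷ x) α β y z over

∼-++ˡ : {A : Set} (x : List A) {u v : List A} → u ∼ v → x ++ u ∼ x ++ v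
∼-++ˡ []      u∼v = u∼v
∼-++ˡ (t ∷ x) u∼v = ∼-cons t (∼-++ˡ x u∼v)

∼-++ʳ : {A : Set} {u v : List A} (z : List A) → u ∼ v → u ++ z ∼ v ++ z
∼-++ʳ {A} t = gmap (_++ t) λ where
    (swap x α β y z over) → subst₂ RuleSE (sym (assoc x α β y z β α)) (sym (assoc x β α y z α β))
                              (swap x α β y (z ++ t) over)
  where
  assoc : (x : List A) (α β : A) (y z : List A) (γ δ : A) →
          (x ++ α ∷ β ∷ y ++ γ ∷ δ ∷ z) ++ t ≡ x ++ α ∷ β ∷ y ++ γ ∷ δ ∷ z ++ t
  assoc x α β y z γ δ = trans (++-assoc x _ t) (cong (λ v → x ++ α ∷ β ∷ v) (++-assoc y _ t))

∼-++ : {A : Set} {u u′ v v′ : List A} → u ∼ u′ → v ∼ v′ → u ++ v ∼ u′ ++ v′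
∼-++ {u′ = u′} {v} u∼u′ v∼v′ = ∼-++ʳ v u∼u′ ◅◅ ∼-++ˡ u′ v∼v′

-- Soundness of Rule SE

module Soundness {A : Set} (_≈?_ : DecidableEquality A) where
  open Counting _≈?_

  -- Holds when u starts with neither α nor β, for any z.
  Inert : A → A → List A → List A → Set
  Inert α β u z = ∀ {v} → Over α β v → count u (v ++ z) ≡ count u z

  inert-∷ : ∀ {α β γ} u z → γ ≢ α → γ ≢ β → Inert α β (γ ∷ u) z
  inert-∷ u z γ≢α γ≢β over = count-skip u z (over-≢ (≢-sym γ≢α) (≢-sym γ≢β) over)

  inert-∉ : ∀ {α β u} z → All (α ≢_) u → All (β ≢_) u → Inert α β u z
  inert-∉         z []        []        over = refl
  inert-∉ {u = _ ∷ u} z (α≢ ∷ _) (β≢ ∷ _) over = inert-∷ u z (≢-sym α≢) (≢-sym β≢) over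

  -- Either the α lies in `v`, and inertness leaves `z` as the only place that contributes to the
  -- count of `u`, or the whole occurrence lies in `z`.
  count-over₁ : ∀ {α β} u z {v} → α ≢ β → Inert α β u z → Over α β v →
                count (α ∷ u) (v ++ z) ≡ count [ α ] v * count u z + count (α ∷ u) z
  count-over₁ u z α≢β inert [] = refl
  count-over₁ {α} {β} u z {_ ∷ v} α≢β inert (inj₁ refl ∷ over)
    rewrite dec-true (α ≈? α) refl | inert over | count-over₁ u z α≢β inert over
    = sym (+-assoc (count u z) _ _)
  count-over₁ {α} {β} u z α≢β inert (inj₂ refl ∷ over)
    rewrite dec-false (β ≈? α) (≢-sym α≢β) = count-over₁ u z α≢β inert over

  count-over₂ : ∀ {α β} u z {v} → α ≢ β → Inert α β u z → Over α β v →
                count (α ∷ β ∷ u) (v ++ z) ≡ count (α ∷ β ∷ []) v * count u z +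
                (count [ α ] v * count (β ∷ u) z + count (α ∷ β ∷ u) z)
  count-over₂ u z α≢β inert [] = refl
  count-over₂ {α} {β} u z {_ ∷ v} α≢β inert (inj₁ refl ∷ over)
    rewrite dec-true (α ≈? α) refl | count-over₂ u z α≢β inert over
          | count-over₁ u z (≢-sym α≢β) (inert ∘ over-sym) (over-sym over)
    = rearrange (count [ β ] v) (count u z) (count (β ∷ u) z) (count (α ∷ β ∷ []) v) (count [ α ] v) (count (α ∷ β ∷ u) z)
    where
    rearrange : ∀ k l m n o p → k * l + m + (n * l + (o * m + p)) ≡ (k + n) * l + ((1 + o) * m + p)
    rearrange = solve-∀
  count-over₂ {α} {β} u z α≢β inert (inj₂ refl ∷ over)
    rewrite dec-false (β ≈? α) (≢-sym α≢β) = count-over₂ u z α≢β inert over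

  -- The factor that Rule SE replaces by `block β α y`.
  block : A → A → List A → List A
  block α β y = α ∷ β ∷ y ++ β ∷ α ∷ []

  block-over : ∀ {α β y} → Over α β y → Over α β (block α β y)
  block-over over = inj₁ refl ∷ inj₂ refl ∷ ++⁺ over (inj₂ refl ∷ inj₁ refl ∷ [])

  block-count₁ : ∀ {α β} y → α ≢ β → count [ α ] (block α β y) ≡ count [ α ] (block β α y)
  block-count₁ {α} {β} y α≢β
    rewrite count-++₁ α y (β ∷ α ∷ []) | count-++₁ α y (α ∷ β ∷ [])
          | dec-true (α ≈? α) refl | dec-false (β ≈? α) (≢-sym α≢β) = refl

  -- The exchange on the left of `y` loses one occurrence of αβ and the exchange on the right gains
  -- one; no other pair of positions changes its contribution.
  block-count₂ : ∀ {α β} y → α ≢ β → count (α ∷ β ∷ []) (block α β y) ≡ count (α ∷ β ∷ []) (block β α y)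
  block-count₂ {α} {β} y α≢β
    rewrite count-++₂ α β y (β ∷ α ∷ []) | count-++₂ α β y (α ∷ β ∷ [])
          | count-++₁ β y (β ∷ α ∷ []) | count-++₁ β y (α ∷ β ∷ [])
          | dec-true (α ≈? α) refl | dec-true (β ≈? β) refl
          | dec-false (β ≈? α) (≢-sym α≢β) | dec-false (α ≈? β) α≢β
    = rearrange (count [ α ] y) (count [ β ] y) (count (α ∷ β ∷ []) y)
    where
    rearrange : ∀ k l m → suc (l + 1 + (m + (k * 1 + 0))) ≡ l + 1 + (m + (k * 1 + 1))
    rearrange = solve-∀

  -- The first letter other than α and β forces itself and everything after it into `z`. As `α ∷ u`
  -- repeats no letter, only α, or αβ when β comes second, can be matched before `z`.
  count-headed : ∀ {α β v v′} → α ≢ β → Over α β v → Over α β v′ → count [ α ] v ≡ count [ α ] v′ →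
                 count (α ∷ β ∷ []) v ≡ count (α ∷ β ∷ []) v′ →
                 ∀ u → Unique (α ∷ u) → ∀ z → count (α ∷ u) (v ++ z) ≡ count (α ∷ u) (v′ ++ z)
  count-headed {α} {β} {v} {v′} α≢β over over′ eq₁ eq₂ u (α∉u ∷ u-unique) z = split u α∉u u-unique
    where
    linear : ∀ u → Inert α β u z → count (α ∷ u) (v ++ z) ≡ count (α ∷ u) (v′ ++ z)
    linear u inert = trans (count-over₁ u z α≢β inert over)
      (trans (cong (λ n → n * count u z + count (α ∷ u) z) eq₁) (sym (count-over₁ u z α≢β inert over′)))

    split : ∀ u → All (α ≢_) u → Unique u → count (α ∷ u) (v ++ z) ≡ count (α ∷ u) (v′ ++ z)
    split []      _           _ = linear [] (λ _ → refl)
    split (δ ∷ u) (α≢δ ∷ α∉u) (δ∉u ∷ _) with δ ≈? β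
    ... | no δ≢β   = linear (δ ∷ u) (inert-∷ u z (≢-sym α≢δ) δ≢β)
    ... | yes refl = trans (count-over₂ u z α≢β inert over)
      (trans (cong₂ (λ m n → n * count u z + (m * count (δ ∷ u) z + count (α ∷ δ ∷ u) z)) eq₁ eq₂)
             (sym (count-over₂ u z α≢β inert over′)))
      where
      inert : Inert α δ u z
      inert = inert-∉ z α∉u δ∉u

  count-block : ∀ {α β y} → α ≢ β → Over α β y → ∀ u → Unique u → ∀ z →
                count u (block α β y ++ z) ≡ count u (block β α y ++ z)
  count-block α≢β over [] _ z = refl
  count-block {α} {β} {y} α≢β over (γ ∷ u) unique z with γ ≈? α | γ ≈? β
  ... | no γ≢α | no γ≢β = trans (inert-∷ u z γ≢α γ≢β (block-over over))
                                (sym (inert-∷ u z γ≢α γ≢β (over-sym (block-over (over-sym over)))))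
  ... | yes refl | _ = count-headed α≢β (block-over over) (over-sym (block-over (over-sym over)))
                         (block-count₁ y α≢β) (block-count₂ y α≢β) u unique z
  ... | no _ | yes refl = count-headed (≢-sym α≢β) (over-sym (block-over over)) (block-over (over-sym over))
                         (sym (block-count₁ y (≢-sym α≢β))) (sym (block-count₂ y (≢-sym α≢β))) u unique z

  -- Unique cannot be dropped: abba ∼ baab, but |abba|_aab = 0 and |baab|_aab = 1.
  count-swap : ∀ {w w′} → RuleSE w w′ → ∀ u → Unique u → count u w ≡ count u w′
  count-swap (swap [] α β y z over) u unique with α ≈? β
  ... | yes refl = refl
  ... | no α≢β   = subst₂ (λ v v′ → count u (α ∷ β ∷ v) ≡ count u (β ∷ α ∷ v′))
                     (++-assoc y _ z) (++-assoc y _ z) (count-block α≢β over u unique z)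
  count-swap (swap (t ∷ x) α β y z over) [] _ = refl
  count-swap (swap (t ∷ x) α β y z over) (s ∷ u) (s∉u ∷ unique) =
    cong₂ (λ m n → (if does (t ≈? s) then m else 0) + n)
      (count-swap (swap x α β y z over) u unique) (count-swap (swap x α β y z over) (s ∷ u) (s∉u ∷ unique))

  count-∼ : ∀ {w w′} → w ∼ w′ → ∀ u → Unique u → count u w ≡ count u w′
  count-∼ ε                _ _      = refl
  count-∼ (w→v ◅ v∼w′) u unique = trans (count-swap w→v u unique) (count-∼ v∼w′ u unique)

  count-transport : ∀ {v v′ w w′ u} → v ∼ v′ → w ∼ w′ → Unique u → count u v ≡ count u w → count u v′ ≡ count u w′
  count-transport {u = u} v∼v′ w∼w′ unique eq =
    trans (sym (count-∼ v∼v′ u unique)) (trans eq (count-∼ w∼w′ u unique))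

  -- Entries on or above the diagonal count segment words, which repeat no letter and so have
  -- invariant counts.
  ∼⇒strong : ∀ {w w′} → w ∼ w′ → StronglyMEquivalent w w′
  ∼⇒strong {w} {w′} w∼w′ s Γ i j with ≤-<-connex (toℕ i) (toℕ j)
  ... | inj₂ j<i = trans (parikh-lower Γ w j<i) (sym (parikh-lower Γ w′ j<i))
  ... | inj₁ i≤j with u , seg ← segment Γ (toℕ j ∸ toℕ i) (m+[n∸m]≡n i≤j) =
    trans (parikh≡count Γ _≈?_ seg w)
      (trans (count-∼ w∼w′ u (segment-unique Γ seg)) (sym (parikh≡count Γ _≈?_ seg w′)))

-- Division with remainder and powers of a letter

division-unique : ∀ {d r r′} q q′ → r < d → r′ < d → r + q * d ≡ r′ + q′ * d → r ≡ r′ × q ≡ q′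
division-unique {d} {r} {r′} zero zero _ _ eq = +-cancelʳ-≡ 0 r r′ eq , refl
division-unique {d} {r} {r′} zero (suc q′) r<d _ eq = contradiction eq
  (<⇒≢ (<-≤-trans (subst (_< d) (sym (+-identityʳ r)) r<d) (≤-trans (m≤m+n d (q′ * d)) (m≤n+m _ r′))))
division-unique {d} {r} {r′} (suc q) zero _ r′<d eq = contradiction (sym eq)
  (<⇒≢ (<-≤-trans (subst (_< d) (sym (+-identityʳ r′)) r′<d) (≤-trans (m≤m+n d (q * d)) (m≤n+m _ r))))
division-unique {d} {r} {r′} (suc q) (suc q′) r<d r′<d eq
  with r≡r′ , q≡q′ ← division-unique q q′ r<d r′<d
         (+-cancelˡ-≡ d _ _ (trans (x∙yz≈y∙xz d r (q * d)) (trans eq (x∙yz≈y∙xz r′ d (q′ * d)))))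
  = r≡r′ , cong suc q≡q′

replicate-snoc : {A : Set} (n : ℕ) (x : A) (w : List A) → replicate n x ++ x ∷ w ≡ x ∷ replicate n x ++ w
replicate-snoc zero    x w = refl
replicate-snoc (suc n) x w = cong (x ∷_) (replicate-snoc n x w)

module Powers {A : Set} (_≈?_ : DecidableEquality A) where
  open Counting _≈?_

  count-replicate-++ : ∀ x n w → count [ x ] (replicate n x ++ w) ≡ n + count [ x ] w
  count-replicate-++ x n w = trans (count-++₁ x (replicate n x) w) (cong (_+ count [ x ] w) (count-replicate x n))

  count-skip-replicate : ∀ {x y} u n w → y ≢ x → count (x ∷ u) (replicate n y ++ w) ≡ count (x ∷ u) w
  count-skip-replicate u n w y≢x = count-skip u w (replicate⁺ n y≢x)

  count₂-replicate-++ : ∀ {x y} u n w → x ≢ y →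
                        count (x ∷ y ∷ u) (replicate n x ++ w) ≡ n * count (y ∷ u) w + count (x ∷ y ∷ u) w
  count₂-replicate-++         u zero    w x≢y = refl
  count₂-replicate-++ {x} {y} u (suc n) w x≢y
    rewrite count-here x (y ∷ u) (replicate n x ++ w) | count-skip-replicate u n w x≢y
          | count₂-replicate-++ u n w x≢y = sym (+-assoc (count (y ∷ u) w) _ _)

-- Words over two letters

module Binary {A : Set} (_≈?_ : DecidableEquality A) {α β : A} (α≢β : α ≢ β) where
  open Counting _≈?_
  open Powers _≈?_
  open Soundness _≈?_

  -- Writing `suc t` keeps s below the number of αs of a mixed word v. Hence s and m are the
  -- remainder and the quotient of |v|_αβ divided by |v|_α.
  data Canonical : List A → Set where
    sorted : ∀ s m → Canonical (replicate s α ++ replicate m β)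
    mixed  : ∀ k s t m → Canonical (replicate k β ++ replicate s α ++ β ∷ replicate (suc t) α ++ replicate m β)

  Normalisable : List A → Set
  Normalisable w = ∃ λ v → w ∼ v × Canonical v

  ∼-normalisable : ∀ {v w} → v ∼ w → Normalisable w → Normalisable v
  ∼-normalisable v∼w (x , w∼x , canonical) = x , v∼w ◅◅ w∼x , canonical

  β-canonical : ∀ {v} → Canonical v → Normalisable (β ∷ v)
  β-canonical (sorted zero m)    = _ , ε , sorted zero (suc m)
  β-canonical (sorted (suc s) m) = _ , ε , mixed zero zero s m
  β-canonical (mixed k s t m)    = _ , ε , mixed (suc k) s t m

  β-normalisable : ∀ {w} → Normalisable w → Normalisable (β ∷ w)
  β-normalisable (v , w∼v , canonical) = ∼-normalisable (∼-cons β w∼v) (β-canonical canonical)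

  -- One application of Rule SE takes the leading α past one β and, in exchange, the isolated β past
  -- one α.
  shift : ∀ k s t w →
          α ∷ replicate (suc k) β ++ replicate s α ++ β ∷ replicate (suc t) α ++ w ∼
          β ∷ α ∷ replicate k β ++ replicate (suc s) α ++ β ∷ replicate t α ++ w
  shift k s t w = subst₂ _∼_
    (cong (λ v → α ∷ β ∷ v) (++-assoc (replicate k β) (replicate s α) _))
    (cong (λ v → β ∷ α ∷ v) (trans (++-assoc (replicate k β) (replicate s α) _)
                                   (cong (replicate k β ++_) (replicate-snoc s α _))))
    (swap [] α β (replicate k β ++ replicate s α) (replicate t α ++ w)
       (++⁺ (replicate⁺ k (inj₂ refl)) (replicate⁺ s (inj₁ refl))) ◅ ε)

  -- Each `shift` brings one β of the first block to the front, so the recursion is on the length of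
  -- that block.
  α-mixed : ∀ k s t m →
            Normalisable (α ∷ replicate k β ++ replicate s α ++ β ∷ replicate (suc t) α ++ replicate m β)
  α-mixed zero          s t       m = _ , ε , mixed zero (suc s) t m
  α-mixed (suc k)       s (suc t) m = ∼-normalisable (shift k s (suc t) _) (β-normalisable (α-mixed k (suc s) t m))
  α-mixed (suc zero)    s zero    m = ∼-normalisable (shift zero s zero _) (β-canonical (sorted (suc (suc s)) (suc m)))
  -- The isolated β has passed its last α and joins the final block; the last β of the first block
  -- takes over as the isolated one.
  α-mixed (suc (suc k)) s zero    m = ∼-normalisable (shift (suc k) s zero _) (β-normalisable
    (subst (λ v → Normalisable (α ∷ v)) (replicate-snoc k β _) (α-mixed k zero s (suc m))))

  α-canonical : ∀ {v} → Canonical v → Normalisable (α ∷ v)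
  α-canonical (sorted s m)    = _ , ε , sorted (suc s) m
  α-canonical (mixed k s t m) = α-mixed k s t m

  normalise : ∀ {w} → Over α β w → Normalisable w
  normalise []                 = _ , ε , sorted zero zero
  normalise (inj₁ refl ∷ over) with v , w∼v , canonical ← normalise over =
    ∼-normalisable (∼-cons α w∼v) (α-canonical canonical)
  normalise (inj₂ refl ∷ over) = β-normalisable (normalise over)

  β≢α : β ≢ α
  β≢α = ≢-sym α≢β

  sorted-count : ∀ s m → count [ α ] (replicate s α ++ replicate m β) ≡ s ×
                         count [ β ] (replicate s α ++ replicate m β) ≡ m ×
                         count (α ∷ β ∷ []) (replicate s α ++ replicate m β) ≡ s * m
  sorted-count s m
    rewrite count-replicate-++ α s (replicate m β) | count-skip-replicate [] s (replicate m β) α≢β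
          | count₂-replicate-++ [] s (replicate m β) α≢β
          | count-absent₁ [] (replicate⁺ m β≢α) | count-absent₁ (β ∷ []) (replicate⁺ m β≢α)
          | count-replicate β m
    = +-identityʳ s , refl , +-identityʳ (s * m)

  mixed-count : ∀ k s t m → let v = replicate k β ++ replicate s α ++ β ∷ replicate (suc t) α ++ replicate m β in
                count [ α ] v ≡ s + suc t × count [ β ] v ≡ k + suc m ×
                count (α ∷ β ∷ []) v ≡ s + m * (s + suc t)
  mixed-count k s t m = mixed-α , mixed-β , mixed-αβ
    where
    open ≡-Reasoning
    tail : List A
    tail = replicate (suc t) α ++ replicate m β

    mixed-α : count [ α ] (replicate k β ++ replicate s α ++ β ∷ tail) ≡ s + suc t
    mixed-α = begin
      count [ α ] (replicate k β ++ replicate s α ++ β ∷ tail) ≡⟨ count-skip-replicate [] k _ β≢α ⟩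
      count [ α ] (replicate s α ++ β ∷ tail)                  ≡⟨ count-replicate-++ α s _ ⟩
      s + count [ α ] (β ∷ tail)                               ≡⟨ cong (s +_) (count-there [] tail β≢α) ⟩
      s + count [ α ] tail                                     ≡⟨ cong (s +_) (proj₁ (sorted-count (suc t) m)) ⟩
      s + suc t                                                ∎

    mixed-β′ : count [ β ] (β ∷ tail) ≡ suc m
    mixed-β′ = trans (count-here β [] tail) (cong suc (proj₁ (proj₂ (sorted-count (suc t) m))))

    mixed-β : count [ β ] (replicate k β ++ replicate s α ++ β ∷ tail) ≡ k + suc m
    mixed-β = begin
      count [ β ] (replicate k β ++ replicate s α ++ β ∷ tail) ≡⟨ count-replicate-++ β k _ ⟩
      k + count [ β ] (replicate s α ++ β ∷ tail)              ≡⟨ cong (k +_) (count-skip-replicate [] s _ α≢β) ⟩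
      k + count [ β ] (β ∷ tail)                               ≡⟨ cong (k +_) mixed-β′ ⟩
      k + suc m                                                ∎

    mixed-αβ : count (α ∷ β ∷ []) (replicate k β ++ replicate s α ++ β ∷ tail) ≡ s + m * (s + suc t)
    mixed-αβ = begin
      count (α ∷ β ∷ []) (replicate k β ++ replicate s α ++ β ∷ tail) ≡⟨ count-skip-replicate _ k _ β≢α ⟩
      count (α ∷ β ∷ []) (replicate s α ++ β ∷ tail)                  ≡⟨ count₂-replicate-++ [] s _ α≢β ⟩
      s * count [ β ] (β ∷ tail) + count (α ∷ β ∷ []) (β ∷ tail)
        ≡⟨ cong₂ (λ p q → s * p + q) mixed-β′ (trans (count-there _ tail β≢α) (proj₂ (proj₂ (sorted-count (suc t) m)))) ⟩
      s * suc m + suc t * m                                           ≡⟨ rearrange s m t ⟩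
      s + m * (s + suc t)                                             ∎
      where
      rearrange : ∀ s m t → s * suc m + suc t * m ≡ s + m * (s + suc t)
      rearrange = solve-∀

  -- With the letter counts fixed, a sorted word has the largest possible number |α||β| of
  -- occurrences of αβ. A mixed word has fewer, as its isolated β precedes some α.
  sorted≢mixed : ∀ {s m s′ t m′} k → s ≡ s′ + suc t → m ≡ k + suc m′ → s * m ≢ s′ + m′ * (s′ + suc t)
  sorted≢mixed {s′ = s′} {t} {m′} k refl refl eq = m≢1+m+n _ (trans (sym eq) (rearrange k s′ t m′))
    where
    rearrange : ∀ k s t m → (s + suc t) * (k + suc m) ≡ suc (s + m * (s + suc t) + (t + k * (s + suc t)))
    rearrange = solve-∀

  canonical-unique : ∀ {u v} → Canonical u → Canonical v → count [ α ] u ≡ count [ α ] v →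
                     count [ β ] u ≡ count [ β ] v → count (α ∷ β ∷ []) u ≡ count (α ∷ β ∷ []) v → u ≡ v
  canonical-unique (sorted s m) (sorted s′ m′) eqα eqβ eqαβ
    with p , q , _ ← sorted-count s m | p′ , q′ , _ ← sorted-count s′ m′
    = cong₂ (λ s m → replicate s α ++ replicate m β) (trans (sym p) (trans eqα p′)) (trans (sym q) (trans eqβ q′))
  canonical-unique (sorted s m) (mixed k s′ t m′) eqα eqβ eqαβ
    with p , q , r ← sorted-count s m | p′ , q′ , r′ ← mixed-count k s′ t m′
    = contradiction (trans (sym r) (trans eqαβ r′))
        (sorted≢mixed k (trans (sym p) (trans eqα p′)) (trans (sym q) (trans eqβ q′)))
  canonical-unique (mixed k s t m) (sorted s′ m′) eqα eqβ eqαβ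
    with p , q , r ← mixed-count k s t m | p′ , q′ , r′ ← sorted-count s′ m′
    = contradiction (trans (sym r′) (trans (sym eqαβ) r))
        (sorted≢mixed k (trans (sym p′) (trans (sym eqα) p)) (trans (sym q′) (trans (sym eqβ) q)))
  canonical-unique (mixed k s t m) (mixed k′ s′ t′ m′) eqα eqβ eqαβ
    with p , q , r ← mixed-count k s t m | p′ , q′ , r′ ← mixed-count k′ s′ t′ m′
    with x≡x′ ← trans (sym p) (trans eqα p′)
    with refl , refl ← division-unique m m′ (m<m+n s (s≤s z≤n)) (subst (s′ <_) (sym x≡x′) (m<m+n s′ (s≤s z≤n)))
                         (trans (sym r) (trans eqαβ (trans r′ (cong (λ x → s′ + m′ * x) (sym x≡x′)))))
    -- Once s and m agree, the number of αs fixes t and the number of βs fixes k.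
    with refl ← suc-injective (+-cancelˡ-≡ s _ _ x≡x′)
    with refl ← +-cancelʳ-≡ (suc m) k k′ (trans (sym q) (trans eqβ q′))
    = refl

  -- Soundness carries the three counts over to the canonical forms, which therefore coincide.
  binary : ∀ {u v} → Over α β u → Over α β v → count [ α ] u ≡ count [ α ] v →
           count [ β ] u ≡ count [ β ] v → count (α ∷ β ∷ []) u ≡ count (α ∷ β ∷ []) v → u ∼ v
  binary {u} {v} over over′ eqα eqβ eqαβ
    with u₀ , u∼u₀ , canonical ← normalise over | v₀ , v∼v₀ , canonical′ ← normalise over′
    with refl ← canonical-unique canonical canonical′ (count-transport u∼u₀ v∼v₀ ([] ∷ []) eqα)
                  (count-transport u∼u₀ v∼v₀ ([] ∷ []) eqβ) (count-transport u∼u₀ v∼v₀ ((α≢β ∷ []) ∷ [] ∷ []) eqαβ)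
    = u∼u₀ ◅◅ ∼-sym v∼v₀

  -- The hypotheses compare the counts of `u ++ replicate m β` with those of
  -- `v ++ replicate (m + e) β`. Cancelling the m common βs leaves the three equalities that
  -- `binary` asks for.
  borrow-right : ∀ {u v} m e → Over α β u → Over α β v → count [ α ] u ≡ count [ α ] v →
                 count [ β ] u + m ≡ count [ β ] v + (m + e) →
                 count (α ∷ β ∷ []) u + count [ α ] u * m ≡ count (α ∷ β ∷ []) v + count [ α ] v * (m + e) →
                 u ∼ v ++ replicate e β
  borrow-right {u} {v} m e over over′ eqα eqβ eqαβ =
    binary over (++⁺ over′ (replicate⁺ e (inj₂ refl))) alphas betas pairs
    where
    alphas : count [ α ] u ≡ count [ α ] (v ++ replicate e β)
    alphas rewrite count-++₁ α v (replicate e β) | count-absent₁ [] (replicate⁺ e β≢α) =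
      trans eqα (sym (+-identityʳ _))

    betas : count [ β ] u ≡ count [ β ] (v ++ replicate e β)
    betas rewrite count-++₁ β v (replicate e β) | count-replicate β e =
      +-cancelʳ-≡ m _ _ (trans eqβ (rearrange (count [ β ] v) m e))
      where
      rearrange : ∀ k m e → k + (m + e) ≡ k + e + m
      rearrange = solve-∀

    pairs : count (α ∷ β ∷ []) u ≡ count (α ∷ β ∷ []) (v ++ replicate e β)
    pairs rewrite count-++₂ α β v (replicate e β) | count-replicate β e | count-absent₁ (β ∷ []) (replicate⁺ e β≢α) =
      +-cancelʳ-≡ (count [ α ] v * m) _ _
        (trans (cong (λ x → count (α ∷ β ∷ []) u + x * m) (sym eqα))
               (trans eqαβ (rearrange (count (α ∷ β ∷ []) v) (count [ α ] v) m e)))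
      where
      rearrange : ∀ k x m e → k + x * (m + e) ≡ k + (x * e + 0) + x * m
      rearrange = solve-∀

  borrow-left : ∀ {u v} m e → Over α β u → Over α β v → count [ β ] u ≡ count [ β ] v →
                count [ α ] u + m ≡ count [ α ] v + (m + e) →
                count (α ∷ β ∷ []) u + m * count [ β ] u ≡ count (α ∷ β ∷ []) v + (m + e) * count [ β ] v →
                u ∼ replicate e α ++ v
  borrow-left {u} {v} m e over over′ eqβ eqα eqαβ =
    binary over (++⁺ (replicate⁺ e (inj₁ refl)) over′) alphas betas pairs
    where
    alphas : count [ α ] u ≡ count [ α ] (replicate e α ++ v)
    alphas rewrite count-replicate-++ α e v =
      +-cancelʳ-≡ m _ _ (trans eqα (rearrange (count [ α ] v) m e))
      where
      rearrange : ∀ k m e → k + (m + e) ≡ e + k + m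
      rearrange = solve-∀

    betas : count [ β ] u ≡ count [ β ] (replicate e α ++ v)
    betas rewrite count-skip-replicate [] e v α≢β = eqβ

    pairs : count (α ∷ β ∷ []) u ≡ count (α ∷ β ∷ []) (replicate e α ++ v)
    pairs rewrite count₂-replicate-++ [] e v α≢β =
      +-cancelʳ-≡ (m * count [ β ] v) _ _
        (trans (cong (λ y → count (α ∷ β ∷ []) u + m * y) (sym eqβ))
               (trans eqαβ (rearrange (count (α ∷ β ∷ []) v) (count [ β ] v) m e)))
      where
      rearrange : ∀ k y m e → k + (m + e) * y ≡ e * y + k + m * y
      rearrange = solve-∀

  -- m and n are the numbers of βs already standing to the right of u and v.  Whichever of u, v
  -- has more βs gives up the excess, so x can be taken to be the other one.
  common-left : ∀ {u v} m n → Over α β u → Over α β v → count [ α ] u ≡ count [ α ] v →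
                count [ β ] u + m ≡ count [ β ] v + n →
                count (α ∷ β ∷ []) u + count [ α ] u * m ≡ count (α ∷ β ∷ []) v + count [ α ] v * n →
                ∃ λ x → ∃₂ λ d e → u ∼ x ++ replicate d β × v ∼ x ++ replicate e β × m + d ≡ n + e
  common-left {u} {v} m n over over′ eqα eqβ eqαβ with ≤-total m n
  ... | inj₁ m≤n with d , refl ← m≤n⇒∃[o]m+o≡n m≤n =
    v , d , 0 , borrow-right m d over over′ eqα eqβ eqαβ , subst (v ∼_) (sym (++-identityʳ v)) ε , sym (+-identityʳ _)
  ... | inj₂ n≤m with e , refl ← m≤n⇒∃[o]m+o≡n n≤m =
    u , 0 , e , subst (u ∼_) (sym (++-identityʳ u)) ε ,
    borrow-right n e over′ over (sym eqα) (sym eqβ) (sym eqαβ) , +-identityʳ _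

  -- Mirror image of `common-left`: m and n are the numbers of αs already standing to the left of
  -- `u` and `v`.
  common-right : ∀ {u v} m n → Over α β u → Over α β v → count [ β ] u ≡ count [ β ] v →
                 count [ α ] u + m ≡ count [ α ] v + n →
                 count (α ∷ β ∷ []) u + m * count [ β ] u ≡ count (α ∷ β ∷ []) v + n * count [ β ] v →
                 ∃ λ x → ∃₂ λ d e → u ∼ replicate d α ++ x × v ∼ replicate e α ++ x × m + d ≡ n + e
  common-right {u} {v} m n over over′ eqβ eqα eqαβ with ≤-total m n
  ... | inj₁ m≤n with d , refl ← m≤n⇒∃[o]m+o≡n m≤n =
    v , d , 0 , borrow-left m d over over′ eqβ eqα eqαβ , ε , sym (+-identityʳ _)
  ... | inj₂ n≤m with e , refl ← m≤n⇒∃[o]m+o≡n n≤m =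
    u , 0 , e , ε , borrow-left n e over′ over (sym eqβ) (sym eqα) (sym eqαβ) , +-identityʳ _

-- Subword counts determined by strong M-equivalence

open Counting _≟_
open Powers _≟_

-- These are the counts that the completeness proof compares. The orders a < b < c and a < c < b
-- provide all of them as matrix entries.
record SameCounts (w w′ : List Letter) : Set where
  field
    same-a   : count [ a ] w ≡ count [ a ] w′
    same-b   : count [ b ] w ≡ count [ b ] w′
    same-c   : count [ c ] w ≡ count [ c ] w′
    same-ab  : count (a ∷ b ∷ []) w ≡ count (a ∷ b ∷ []) w′
    same-ac  : count (a ∷ c ∷ []) w ≡ count (a ∷ c ∷ []) w′
    same-bc  : count (b ∷ c ∷ []) w ≡ count (b ∷ c ∷ []) w′
    same-cb  : count (c ∷ b ∷ []) w ≡ count (c ∷ b ∷ []) w′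
    same-acb : count (a ∷ c ∷ b ∷ []) w ≡ count (a ∷ c ∷ b ∷ []) w′

order-abc order-acb : OrderedAlphabet Letter 3
order-abc = mk↔ₛ′ (λ { a → 0F ; b → 1F ; c → 2F }) (λ { 0F → a ; 1F → b ; 2F → c })
  (λ { 0F → refl ; 1F → refl ; 2F → refl }) (λ { a → refl ; b → refl ; c → refl })
order-acb = mk↔ₛ′ (λ { a → 0F ; c → 1F ; b → 2F }) (λ { 0F → a ; 1F → c ; 2F → b })
  (λ { 0F → refl ; 1F → refl ; 2F → refl }) (λ { a → refl ; b → refl ; c → refl })

strong⇒count : ∀ {s i j u} w w′ (Γ : OrderedAlphabet Letter s) → StronglyMEquivalent w w′ →
               Segment Γ j i u → count u w ≡ count u w′
strong⇒count {s} {i} {j} w w′ Γ strong seg =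
  trans (sym (parikh≡count Γ _≟_ seg w)) (trans (strong s Γ i j) (parikh≡count Γ _≟_ seg w′))

strong⇒sameCounts : ∀ {w w′} → StronglyMEquivalent w w′ → SameCounts w w′
strong⇒sameCounts {w} {w′} strong = record
  { same-a   = strong⇒count w w′ order-abc strong (step 0F stop)
  ; same-b   = strong⇒count w w′ order-abc strong (step 1F stop)
  ; same-c   = strong⇒count w w′ order-abc strong (step 2F stop)
  ; same-ab  = strong⇒count w w′ order-abc strong (step 0F (step 1F stop))
  ; same-bc  = strong⇒count w w′ order-abc strong (step 1F (step 2F stop))
  ; same-ac  = strong⇒count w w′ order-acb strong (step 0F (step 1F stop))
  ; same-cb  = strong⇒count w w′ order-acb strong (step 1F (step 2F stop))
  ; same-acb = strong⇒count w w′ order-acb strong (step 0F (step 1F (step 2F stop)))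
  }

-- Factorisation of words with at most one abc

no-c : ∀ w → count [ c ] w ≡ 0 → Over a b w
no-c []      _  = []
no-c (a ∷ w) eq = inj₁ refl ∷ no-c w eq
no-c (b ∷ w) eq = inj₂ refl ∷ no-c w eq

-- The cut is made before the first a, since no c can follow it.
no-ac : ∀ w → count (a ∷ c ∷ []) w ≡ 0 → ∃₂ λ p r → w ≡ p ++ r × Over b c p × Over a b r
no-ac []      _  = [] , [] , refl , [] , []
no-ac (a ∷ w) eq = [] , a ∷ w , refl , [] , inj₁ refl ∷ no-c w (m+n≡0⇒m≡0 _ eq)
no-ac (b ∷ w) eq with p , r , refl , over-p , over-r ← no-ac w eq = b ∷ p , r , refl , inj₁ refl ∷ over-p , over-r
no-ac (c ∷ w) eq with p , r , refl , over-p , over-r ← no-ac w eq = c ∷ p , r , refl , inj₂ refl ∷ over-p , over-r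

no-bc : ∀ w → count (b ∷ c ∷ []) w ≡ 0 → ∃₂ λ q r → w ≡ q ++ r × Over a c q × Over a b r
no-bc []      _  = [] , [] , refl , [] , []
no-bc (b ∷ w) eq = [] , b ∷ w , refl , [] , inj₂ refl ∷ no-c w (m+n≡0⇒m≡0 _ eq)
no-bc (a ∷ w) eq with q , r , refl , over-q , over-r ← no-bc w eq = a ∷ q , r , refl , inj₁ refl ∷ over-q , over-r
no-bc (c ∷ w) eq with q , r , refl , over-q , over-r ← no-bc w eq = c ∷ q , r , refl , inj₂ refl ∷ over-q , over-r

-- The first cut is made before the first a. What follows that a contains no bc, and is cut again
-- before its first b.
no-abc : ∀ w → count (a ∷ b ∷ c ∷ []) w ≡ 0 →
         ∃ λ p → ∃₂ λ q r → w ≡ p ++ q ++ r × Over b c p × Over a c q × Over a b r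
no-abc []      _  = [] , [] , [] , refl , [] , [] , []
no-abc (a ∷ w) eq with q , r , refl , over-q , over-r ← no-bc w (m+n≡0⇒m≡0 _ eq) =
  [] , a ∷ q , r , refl , [] , inj₁ refl ∷ over-q , over-r
no-abc (b ∷ w) eq with p , q , r , refl , over-p , over-qr ← no-abc w eq =
  b ∷ p , q , r , refl , inj₁ refl ∷ over-p , over-qr
no-abc (c ∷ w) eq with p , q , r , refl , over-p , over-qr ← no-abc w eq =
  c ∷ p , q , r , refl , inj₂ refl ∷ over-p , over-qr

m+n≡1 : ∀ m {n} → m + n ≡ 1 → (m ≡ 1 × n ≡ 0) ⊎ (m ≡ 0 × n ≡ 1)
m+n≡1 zero          eq = inj₂ (refl , eq)
m+n≡1 (suc zero)    eq = inj₁ (refl , suc-injective eq)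

single : List Letter → ℕ → ℕ → List Letter → List Letter
single p i j s = p ++ a ∷ replicate i c ++ b ∷ replicate j a ++ c ∷ s

one-c : ∀ w → count [ c ] w ≡ 1 → count (b ∷ c ∷ []) w ≡ 0 →
        ∃₂ λ j s → w ≡ replicate j a ++ c ∷ s × Over a b s
one-c (a ∷ w) eq₁ eq₂ with j , s , refl , over ← one-c w eq₁ eq₂ = suc j , s , refl , over
one-c (b ∷ w) eq₁ eq₂ = contradiction (trans (sym eq₁) (m+n≡0⇒m≡0 _ eq₂)) λ ()
one-c (c ∷ w) eq₁ eq₂ = zero , w , refl , no-c w (suc-injective eq₁)

-- An a before the b of the only bc would complete an abc, so nothing but cs precedes that b.
one-bc : ∀ w → count (b ∷ c ∷ []) w ≡ 1 → count (a ∷ b ∷ c ∷ []) w ≡ 0 →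
         ∃ λ i → ∃₂ λ j s → w ≡ replicate i c ++ b ∷ replicate j a ++ c ∷ s × Over a b s
one-bc (a ∷ w) eq₁ eq₂ = contradiction (trans (sym eq₁) (m+n≡0⇒m≡0 _ eq₂)) λ ()
one-bc (c ∷ w) eq₁ eq₂ with i , j , s , refl , over ← one-bc w eq₁ eq₂ = suc i , j , s , refl , over
one-bc (b ∷ w) eq₁ eq₂ with m+n≡1 (count [ c ] w) eq₁
... | inj₁ (c≡1 , bc≡0) with j , s , refl , over ← one-c w c≡1 bc≡0 = zero , j , s , refl , over
... | inj₂ (c≡0 , bc≡1) = contradiction (trans (sym bc≡1) (count-cons-zero b [ c ] w c≡0)) λ ()

-- The only abc starts at the first a: without a bc after that a there would be no abc after it
-- either.
one-abc : ∀ w → count (a ∷ b ∷ c ∷ []) w ≡ 1 →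
          ∃₂ λ p i → ∃₂ λ j s → w ≡ single p i j s × Over b c p × Over a b s
one-abc (b ∷ w) eq with p , i , j , s , refl , over-p , over-s ← one-abc w eq =
  b ∷ p , i , j , s , refl , inj₁ refl ∷ over-p , over-s
one-abc (c ∷ w) eq with p , i , j , s , refl , over-p , over-s ← one-abc w eq =
  c ∷ p , i , j , s , refl , inj₂ refl ∷ over-p , over-s
one-abc (a ∷ w) eq with m+n≡1 (count (b ∷ c ∷ []) w) eq
... | inj₁ (bc≡1 , abc≡0) with i , j , s , refl , over ← one-bc w bc≡1 abc≡0 = [] , i , j , s , refl , [] , over
... | inj₂ (bc≡0 , abc≡1) = contradiction (trans (sym abc≡1) (count-cons-zero a (b ∷ c ∷ []) w bc≡0)) λ ()

bc-≢a : ∀ {w} → Over b c w → All (_≢ a) w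
bc-≢a = over-≢ (λ ()) (λ ())

ac-≢b : ∀ {w} → Over a c w → All (_≢ b) w
ac-≢b = over-≢ (λ ()) (λ ())

ab-≢c : ∀ {w} → Over a b w → All (_≢ c) w
ab-≢c = over-≢ (λ ()) (λ ())

-- `BC` and `CB` concern the same two letters, but `common-left` splits off final cs in the first
-- and final bs in the second.
module BC = Binary _≟_ {b} {c} (λ ())
module CB = Binary _≟_ {c} {b} (λ ())
module AC = Binary _≟_ {a} {c} (λ ())
module AB = Binary _≟_ {a} {b} (λ ())

-- Words with exactly one abc

module SingleCounts {p : List Letter} {i j : ℕ} {s : List Letter} (over-p : Over b c p) (over-s : Over a b s) where
  tail middle : List Letter
  tail   = replicate j a ++ c ∷ s
  middle = replicate i c ++ b ∷ tail

  tail-c : count [ c ] tail ≡ 1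
  tail-c rewrite count-skip-replicate {c} {a} [] j (c ∷ s) (λ ()) | count-absent₁ [] (ab-≢c over-s) = refl

  tail-b : count [ b ] tail ≡ count [ b ] s
  tail-b = count-skip-replicate [] j (c ∷ s) λ ()

  middle-b : count [ b ] middle ≡ suc (count [ b ] s)
  middle-b rewrite count-skip-replicate {b} {c} [] i (b ∷ tail) (λ ()) | tail-b = refl

  middle-c : count [ c ] middle ≡ i + 1
  middle-c rewrite count-replicate-++ c i (b ∷ tail) | tail-c = refl

  single-a : count [ a ] (single p i j s) ≡ suc (j + count [ a ] s)
  single-a rewrite count-skip [] (a ∷ middle) (bc-≢a over-p) | count-skip-replicate {a} {c} [] i (b ∷ tail) (λ ())
    | count-replicate-++ a j (c ∷ s) = refl

  single-b : count [ b ] (single p i j s) ≡ count [ b ] p + suc (count [ b ] s)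
  single-b rewrite count-++₁ b p (a ∷ middle) | middle-b = refl

  single-c : count [ c ] (single p i j s) ≡ count [ c ] p + (i + 1)
  single-c rewrite count-++₁ c p (a ∷ middle) | middle-c = refl

  single-ab : count (a ∷ b ∷ []) (single p i j s) ≡ suc (count [ b ] s) + (j * count [ b ] s + count (a ∷ b ∷ []) s)
  single-ab rewrite count-skip [ b ] (a ∷ middle) (bc-≢a over-p) | middle-b
    | count-skip-replicate {a} {c} [ b ] i (b ∷ tail) (λ ())
    | count₂-replicate-++ {x = a} {b} [] j (c ∷ s) (λ ()) = refl

  single-ac : count (a ∷ c ∷ []) (single p i j s) ≡ i + 1 + j
  single-ac rewrite count-skip [ c ] (a ∷ middle) (bc-≢a over-p) | middle-c
    | count-skip-replicate {a} {c} [ c ] i (b ∷ tail) (λ ())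
    | count₂-replicate-++ {x = a} {c} [] j (c ∷ s) (λ ())
    | count-absent₁ [] (ab-≢c over-s) | count-absent₂ {a} [] (ab-≢c over-s)
    | *-identityʳ j | +-identityʳ j = refl

  single-bc : count (b ∷ c ∷ []) (single p i j s) ≡ count (b ∷ c ∷ []) p + (count [ b ] p * (i + 1) + 1)
  single-bc rewrite count-++₂ b c p (a ∷ middle) | middle-c
    | count-skip-replicate {b} {c} [ c ] i (b ∷ tail) (λ ()) | tail-c
    | count-skip-replicate {b} {a} [ c ] j (c ∷ s) (λ ())
    | count-absent₂ {b} [] (ab-≢c over-s) = refl

  -- The b in the middle closes the i occurrences of ac before it, whereas each b of `s` closes all
  -- i + 1 + j of them.
  single-acb : count (a ∷ c ∷ b ∷ []) (single p i j s) ≡ i + count [ b ] s * (i + 1 + j)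
  single-acb rewrite count-skip (c ∷ b ∷ []) (a ∷ middle) (bc-≢a over-p)
    | count₂-replicate-++ {x = c} {b} [] i (b ∷ tail) (λ ()) | tail-b
    | count-skip-replicate {c} {a} [ b ] j (c ∷ s) (λ ())
    | count-skip-replicate {a} {c} (c ∷ b ∷ []) i (b ∷ tail) (λ ())
    | count₂-replicate-++ {x = a} {c} [ b ] j (c ∷ s) (λ ())
    | count-absent₁ [ b ] (ab-≢c over-s) | count-absent₂ {a} [ b ] (ab-≢c over-s)
    = rearrange i j (count [ b ] s)
    where
    rearrange : ∀ i j n → i * suc n + (n + 0) + (j * (n + 0) + 0) ≡ i + n * (i + 1 + j)
    rearrange = solve-∀

one-abc-complete : ∀ {w w′} → count (a ∷ b ∷ c ∷ []) w ≡ 1 → count (a ∷ b ∷ c ∷ []) w′ ≡ 1 →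
                   SameCounts w w′ → w ∼ w′
one-abc-complete {w} {w′} eq eq′ same
  with p , i , j , s , refl , over-p , over-s ← one-abc w eq
     | p′ , i′ , j′ , s′ , refl , over-p′ , over-s′ ← one-abc w′ eq′ = conclude
  where
  open SameCounts same
  module U = SingleCounts {p} {i} {j} {s} over-p over-s
  module V = SingleCounts {p′} {i′} {j′} {s′} over-p′ over-s′

  bound : ∀ i j → i < i + 1 + j
  bound i j = ≤-trans (m<m+n i (s≤s z≤n)) (m≤m+n (i + 1) j)

  ac-eq : i + 1 + j ≡ i′ + 1 + j′
  ac-eq = trans (sym U.single-ac) (trans same-ac V.single-ac)

  division : i ≡ i′ × count [ b ] s ≡ count [ b ] s′
  division = division-unique _ _ (bound i j) (subst (i′ <_) (sym ac-eq) (bound i′ j′))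
    (trans (sym U.single-acb) (trans same-acb (trans V.single-acb
      (cong (λ n → i′ + count [ b ] s′ * n) (sym ac-eq)))))

  conclude : single p i j s ∼ single p′ i′ j′ s′
  -- With i known, |w|_ac = i + 1 + j yields j; the remaining counts of `p` and `s` then follow by
  -- cancellation.
  conclude with refl , s-b ← division with refl ← +-cancelˡ-≡ (i + 1) j j′ ac-eq =
    ∼-++ (BC.binary over-p over-p′ p-b p-c p-bc)
         (∼-cons a (∼-++ˡ (replicate i c) (∼-cons b (∼-++ˡ (replicate j a) (∼-cons c (AB.binary over-s over-s′ s-a s-b s-ab))))))
    where
    p-b : count [ b ] p ≡ count [ b ] p′
    p-b = +-cancelʳ-≡ (suc (count [ b ] s)) _ _
      (trans (sym U.single-b) (trans same-b (trans V.single-b (cong (λ n → count [ b ] p′ + suc n) (sym s-b)))))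

    p-c : count [ c ] p ≡ count [ c ] p′
    p-c = +-cancelʳ-≡ (i + 1) _ _ (trans (sym U.single-c) (trans same-c V.single-c))

    p-bc : count (b ∷ c ∷ []) p ≡ count (b ∷ c ∷ []) p′
    p-bc = +-cancelʳ-≡ (count [ b ] p * (i + 1) + 1) _ _
      (trans (sym U.single-bc) (trans same-bc (trans V.single-bc
        (cong (λ n → count (b ∷ c ∷ []) p′ + (n * (i + 1) + 1)) (sym p-b)))))

    s-a : count [ a ] s ≡ count [ a ] s′
    s-a = +-cancelˡ-≡ (suc j) _ _ (trans (sym U.single-a) (trans same-a V.single-a))

    s-ab : count (a ∷ b ∷ []) s ≡ count (a ∷ b ∷ []) s′
    s-ab = +-cancelˡ-≡ (j * count [ b ] s) _ _ (+-cancelˡ-≡ (suc (count [ b ] s)) _ _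
      (trans (sym U.single-ab) (trans same-ab (trans V.single-ab
        (cong (λ n → suc n + (j * n + count (a ∷ b ∷ []) s′)) (sym s-b))))))

-- Words without ac

module FactoredCounts₂ {p r : List Letter} (over-p : Over b c p) (over-r : Over a b r) where
  count-a : count [ a ] (p ++ r) ≡ count [ a ] r
  count-a = count-skip [] r (bc-≢a over-p)

  count-b : count [ b ] (p ++ r) ≡ count [ b ] p + count [ b ] r
  count-b = count-++₁ b p r

  count-c : count [ c ] (p ++ r) ≡ count [ c ] p
  count-c rewrite count-++₁ c p r | count-absent₁ [] (ab-≢c over-r) = +-identityʳ _

  count-ab : count (a ∷ b ∷ []) (p ++ r) ≡ count (a ∷ b ∷ []) r
  count-ab = count-skip [ b ] r (bc-≢a over-p)

  count-cb : count (c ∷ b ∷ []) (p ++ r) ≡ count (c ∷ b ∷ []) p + count [ c ] p * count [ b ] r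
  count-cb rewrite count-++₂ c b p r | count-absent₁ [ b ] (ab-≢c over-r) | +-identityʳ (count [ c ] p * count [ b ] r) = refl

no-ac-complete : ∀ {w w′} → count (a ∷ c ∷ []) w ≡ 0 → count (a ∷ c ∷ []) w′ ≡ 0 → SameCounts w w′ → w ∼ w′
no-ac-complete {w} {w′} eq eq′ same
  with p , r , refl , over-p , over-r ← no-ac w eq | p′ , r′ , refl , over-p′ , over-r′ ← no-ac w′ eq′ = conclude
  where
  open SameCounts same
  module U = FactoredCounts₂ over-p over-r
  module V = FactoredCounts₂ over-p′ over-r′

  conclude : p ++ r ∼ p′ ++ r′
  conclude
    -- The counts do not fix how the bs are shared between `p` and `r`. The excess bs at the end of
    -- `p` or `p′` are therefore handed over to its right neighbour.
    with x , d , e , p∼ , p′∼ , b-eq ← CB.common-left (count [ b ] r) (count [ b ] r′) (over-sym over-p) (over-sym over-p′)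
           (trans (sym U.count-c) (trans same-c V.count-c))
           (trans (sym U.count-b) (trans same-b V.count-b))
           (trans (sym U.count-cb) (trans same-cb V.count-cb))
    = ∼-++ʳ r p∼ ◅◅ subst₂ _∼_ (sym (++-assoc x _ r)) (sym (++-assoc x _ r′)) (∼-++ˡ x suffix) ◅◅ ∼-++ʳ r′ (∼-sym p′∼)
    where
    extend : ∀ k {v} → Over a b v → Over a b (replicate k b ++ v)
    extend k over = ++⁺ (replicate⁺ k (inj₂ refl)) over

    skip-b : ∀ u k v → count (a ∷ u) (replicate k b ++ v) ≡ count (a ∷ u) v
    skip-b u k v = count-skip-replicate u k v λ ()

    suffix : replicate d b ++ r ∼ replicate e b ++ r′
    suffix = AB.binary (extend d over-r) (extend e over-r′)
      (trans (skip-b [] d r) (trans (sym U.count-a) (trans same-a (trans V.count-a (sym (skip-b [] e r′))))))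
      (trans (count-replicate-++ b d r) (trans (+-comm d _) (trans b-eq (trans (+-comm _ e) (sym (count-replicate-++ b e r′))))))
      (trans (skip-b [ b ] d r) (trans (sym U.count-ab) (trans same-ab (trans V.count-ab (sym (skip-b [ b ] e r′))))))

-- Words with ac but without abc

module FactoredCounts₃ {p q r : List Letter} (over-p : Over b c p) (over-q : Over a c q) (over-r : Over a b r) where
  -- The summand of `r` is put first to fit the hypotheses of `common-right`.
  count-a : count [ a ] (p ++ q ++ r) ≡ count [ a ] r + count [ a ] q
  count-a rewrite count-skip [] (q ++ r) (bc-≢a over-p) | count-++₁ a q r = +-comm (count [ a ] q) _

  count-b : count [ b ] (p ++ q ++ r) ≡ count [ b ] p + count [ b ] r
  count-b rewrite count-++₁ b p (q ++ r) | count-skip [] r (ac-≢b over-q) = refl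

  count-c : count [ c ] (p ++ q ++ r) ≡ count [ c ] p + count [ c ] q
  count-c rewrite count-++₁ c p (q ++ r) | count-++₁ c q r | count-absent₁ [] (ab-≢c over-r)
    | +-identityʳ (count [ c ] q) = refl

  count-ab : count (a ∷ b ∷ []) (p ++ q ++ r) ≡ count (a ∷ b ∷ []) r + count [ a ] q * count [ b ] r
  count-ab rewrite count-skip [ b ] (q ++ r) (bc-≢a over-p) | count-++₂ a b q r | count-absent₂ {a} [] (ac-≢b over-q)
    = +-comm (count [ a ] q * count [ b ] r) _

  count-ac : count (a ∷ c ∷ []) (p ++ q ++ r) ≡ count (a ∷ c ∷ []) q
  count-ac rewrite count-skip [ c ] (q ++ r) (bc-≢a over-p) | count-++₂ a c q r
    | count-absent₁ [] (ab-≢c over-r) | count-absent₂ {a} [] (ab-≢c over-r) | *-zeroʳ (count [ a ] q) = +-identityʳ _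

  count-bc : count (b ∷ c ∷ []) (p ++ q ++ r) ≡ count (b ∷ c ∷ []) p + count [ b ] p * count [ c ] q
  count-bc rewrite count-++₂ b c p (q ++ r) | count-skip [ c ] r (ac-≢b over-q) | count-absent₂ {b} [] (ab-≢c over-r)
    | count-++₁ c q r | count-absent₁ [] (ab-≢c over-r) | +-identityʳ (count [ c ] q)
    | +-identityʳ (count [ b ] p * count [ c ] q) = refl

  -- As `p` has no a and `r` has no c, the letters a and c both come from `q`; as `q` has no b, the
  -- b comes from `r`.
  count-acb : count (a ∷ c ∷ b ∷ []) (p ++ q ++ r) ≡ count (a ∷ c ∷ []) q * count [ b ] r
  count-acb rewrite count-skip (c ∷ b ∷ []) (q ++ r) (bc-≢a over-p) | count-++₃ a c b q r
    | count-cons-zero a (c ∷ b ∷ []) q (count-absent₂ [] (ac-≢b over-q))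
    | count-absent₁ [ b ] (ab-≢c over-r) | count-absent₂ {a} [ b ] (ab-≢c over-r)
    | *-zeroʳ (count [ a ] q) = +-identityʳ _

no-abc-complete : ∀ {w w′ k} → count (a ∷ c ∷ []) w ≡ suc k → count (a ∷ b ∷ c ∷ []) w ≡ 0 →
                  count (a ∷ b ∷ c ∷ []) w′ ≡ 0 → SameCounts w w′ → w ∼ w′
no-abc-complete {w} {w′} {k} positive eq eq′ same
  with p , q , r , refl , over-p , over-q , over-r ← no-abc w eq
     | p′ , q′ , r′ , refl , over-p′ , over-q′ , over-r′ ← no-abc w′ eq′ = conclude
  where
  open SameCounts same
  module U = FactoredCounts₃ over-p over-q over-r
  module V = FactoredCounts₃ over-p′ over-q′ over-r′

  q-ac : count (a ∷ c ∷ []) q ≡ suc k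
  q-ac = trans (sym U.count-ac) positive

  q-ac′ : count (a ∷ c ∷ []) q′ ≡ suc k
  q-ac′ = trans (sym V.count-ac) (trans (sym same-ac) positive)

  r-b : count [ b ] r ≡ count [ b ] r′
  -- `suc k` is |w|_ac; being positive, it can be cancelled from |w|_acb.
  r-b = *-cancelˡ-≡ _ _ (suc k) (trans (cong (_* count [ b ] r) (sym q-ac)) (trans (sym U.count-acb)
    (trans same-acb (trans V.count-acb (cong (_* count [ b ] r′) q-ac′)))))

  p-b : count [ b ] p ≡ count [ b ] p′
  p-b = +-cancelʳ-≡ (count [ b ] r) _ _
    (trans (sym U.count-b) (trans same-b (trans V.count-b (cong (count [ b ] p′ +_) (sym r-b)))))

  conclude : p ++ q ++ r ∼ p′ ++ q′ ++ r′
  conclude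
    with x , d , e , p∼ , p′∼ , c-eq ← BC.common-left (count [ c ] q) (count [ c ] q′) over-p over-p′ p-b
           (trans (sym U.count-c) (trans same-c V.count-c))
           (trans (sym U.count-bc) (trans same-bc V.count-bc))
       | y , f , g , r∼ , r′∼ , a-eq ← AB.common-right (count [ a ] q) (count [ a ] q′) over-r over-r′ r-b
           (trans (sym U.count-a) (trans same-a V.count-a))
           (trans (sym U.count-ab) (trans same-ab V.count-ab))
    = ∼-++ p∼ (∼-++ˡ q r∼) ◅◅ subst₂ _∼_ (regroup d q f) (regroup e q′ g) (∼-++ˡ x (∼-++ʳ y core))
      ◅◅ ∼-sym (∼-++ p′∼ (∼-++ˡ q′ r′∼))
    where
    -- The middle factor after it has received cs from its left neighbour and as from its right
    -- neighbour.
    padded : ℕ → List Letter → ℕ → List Letter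
    padded m v n = replicate m c ++ v ++ replicate n a

    regroup : ∀ m v n → x ++ padded m v n ++ y ≡ (x ++ replicate m c) ++ v ++ replicate n a ++ y
    regroup m v n = trans (cong (x ++_) (trans (++-assoc (replicate m c) _ y) (cong (replicate m c ++_) (++-assoc v _ y))))
                          (sym (++-assoc x _ _))

    padded-over : ∀ m {v} n → Over a c v → Over a c (padded m v n)
    padded-over m n over = ++⁺ (replicate⁺ m (inj₂ refl)) (++⁺ over (replicate⁺ n (inj₁ refl)))

    padded-a : ∀ m v n → count [ a ] (padded m v n) ≡ count [ a ] v + n
    padded-a m v n rewrite count-skip-replicate {a} {c} [] m (v ++ replicate n a) (λ ())
      | count-++₁ a v (replicate n a) | count-replicate a n = refl

    padded-c : ∀ m v n → count [ c ] (padded m v n) ≡ count [ c ] v + m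
    padded-c m v n rewrite count-replicate-++ c m (v ++ replicate n a) | count-++₁ c v (replicate n a)
      | count-absent₁ {c} [] (replicate⁺ {x = a} n (λ ())) | +-identityʳ (count [ c ] v) = +-comm m _

    -- The received cs have no a before them and the received as no c after them, so the trade
    -- creates no ac.
    padded-ac : ∀ m v n → count (a ∷ c ∷ []) (padded m v n) ≡ count (a ∷ c ∷ []) v
    padded-ac m v n rewrite count-skip-replicate {a} {c} [ c ] m (v ++ replicate n a) (λ ())
      | count-++₂ a c v (replicate n a) | count-absent₁ {c} [] (replicate⁺ {x = a} n (λ ()))
      | count-absent₂ {a} {c} [] (replicate⁺ {x = a} n (λ ())) | *-zeroʳ (count [ a ] v) = +-identityʳ _

    core : padded d q f ∼ padded e q′ g
    core = AC.binary (padded-over d f over-q) (padded-over e g over-q′)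
      (trans (padded-a d q f) (trans a-eq (sym (padded-a e q′ g))))
      (trans (padded-c d q f) (trans c-eq (sym (padded-c e q′ g))))
      (trans (padded-ac d q f) (trans q-ac (trans (sym q-ac′) (sym (padded-ac e q′ g)))))

-- The case distinction on |w|_abc and |w|_ac

complete : ∀ {w w′} → count (a ∷ b ∷ c ∷ []) w ≡ count (a ∷ b ∷ c ∷ []) w′ → count (a ∷ b ∷ c ∷ []) w′ ≤ 1 →
           SameCounts w w′ → w ∼ w′
complete {w} {w′} eq bound same with count (a ∷ b ∷ c ∷ []) w′ in abc′ | count (a ∷ c ∷ []) w in ac
... | zero     | zero  = no-ac-complete ac (trans (sym (SameCounts.same-ac same)) ac) same
... | zero     | suc k = no-abc-complete ac eq abc′ same
... | suc zero | _     = one-abc-complete eq abc′ same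
... | suc (suc _) | _  = contradiction bound λ { (s≤s ()) }

theorem4p2 : (w w′ : List Letter) →
    occurrences _≟_ w (a ∷ b ∷ c ∷ []) ≡ occurrences _≟_ w′ (a ∷ b ∷ c ∷ []) →
    occurrences _≟_ w′ (a ∷ b ∷ c ∷ []) ≤ 1 →
    StronglyMEquivalent w w′ ⇔ MSEEquivalent w w′
theorem4p2 w w′ eq bound = mk⇔
  (λ strong → complete (trans (sym (occurrences≡count w abc)) (trans eq (occurrences≡count w′ abc)))
                       (subst (_≤ 1) (occurrences≡count w′ abc) bound) (strong⇒sameCounts {w} {w′} strong))
  (Soundness.∼⇒strong _≟_)
  where
  abc : List Letter
  abc = a ∷ b ∷ c ∷ []
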